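{- Every finite simple biconnected outerplanar graph $G$ with maximum degree $\Delta = 6$ satisfies $\chi(G^2) = 7$.
   Context: $G^2$ is the graph on $V(G)$ in which two distinct vertices are adjacent iff their distance in $G$ is 1 or 2; $\chi$ is the chromatic number. -}

module Defs where

open import Data.Nat using (ℕ; _≤_; _<_)
open import Data.Fin using (Fin) renaming (_<_ to _<ᶠ_)
open import Data.Fin.Permutation using (Permutation′; _⟨$⟩ʳ_)
open import Data.Bool using (Bool; true; false)
open import Data.List using (length; filterᵇ; allFin)
open import Data.Product using (Σ; ∃; _×_; _,_)
open import Data.Unit using (⊤)
open import Data.Sum using (_⊎_)
open import Relation.Nullary using (¬_)
open import Relation.Binary.PropositionalEquality using (_≡_; _≢_)

record Graph (n : ℕ) : Set where
  field
    adj    : Fin n → Fin n → Bool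
    sym    : ∀ u v → adj u v ≡ adj v u
    irrefl : ∀ v → adj v v ≡ false
open Graph public

Edge : ∀ {n} → Graph n → Fin n → Fin n → Set
Edge G u v = adj G u v ≡ true

degree : ∀ {n} → Graph n → Fin n → ℕ
degree {n} G v = length (filterᵇ (adj G v) (allFin n))

MaxDegree : ∀ {n} → Graph n → ℕ → Set
MaxDegree G Δ = (∀ v → degree G v ≤ Δ) × ∃ λ v → degree G v ≡ Δ

-- walks whose vertices after the start all satisfy Allowed
data Walk {n} (G : Graph n) (Allowed : Fin n → Set) : Fin n → Fin n → Set where
  here : ∀ {x} → Walk G Allowed x x
  step : ∀ {x y z} → Edge G x y → Allowed y → Walk G Allowed y z → Walk G Allowed x z

Connected : ∀ {n} → Graph n → Set
Connected G = ∀ x y → Walk G (λ _ → ⊤) x y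

Biconnected : ∀ {n} → Graph n → Set
Biconnected {n} G =
  (3 ≤ n) × Connected G ×
  (∀ v x y → x ≢ v → y ≢ v → Walk G (λ w → w ≢ v) x y)

-- outerplanar (combinatorial form): the vertices can be placed in a linear
-- (equivalently, cyclic) order on the boundary so that no two edges cross
Outerplanar : ∀ {n} → Graph n → Set
Outerplanar {n} G = Σ (Permutation′ n) λ π →
  ∀ a b c d → Edge G a b → Edge G c d →
    ¬ ((π ⟨$⟩ʳ a) <ᶠ (π ⟨$⟩ʳ c) × (π ⟨$⟩ʳ c) <ᶠ (π ⟨$⟩ʳ b) × (π ⟨$⟩ʳ b) <ᶠ (π ⟨$⟩ʳ d))

Adj² : ∀ {n} → Graph n → Fin n → Fin n → Set
Adj² G u v = u ≢ v × (Edge G u v ⊎ ∃ λ w → Edge G u w × Edge G w v)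

Colorable : ∀ {n} → (Fin n → Fin n → Set) → ℕ → Set
Colorable {n} R k = Σ (Fin n → Fin k) λ c → ∀ u v → R u v → c u ≢ c v

ChromaticNumber : ∀ {n} → (Fin n → Fin n → Set) → ℕ → Set
ChromaticNumber R k = Colorable R k × (∀ j → j < k → ¬ Colorable R j)

{-# OPTIONS --safe #-}

-- Lower bound: a vertex of degree 6 and its neighbours form a 7-clique in G².
--
-- Upper bound: biconnectivity makes consecutive vertices of the outerplanar order adjacent, so an
-- interval [i, j] with more than two vertices splits at the first neighbour w of j inside it: every
-- edge within [i, j], except possibly ij, lies in [i, w] or in [w, j], and wj is an edge.  Give i and
-- j two distinct colours.  All that the rest of the graph sees of a colouring of [i, j] is the set of
-- colours of the inner neighbours of i and of those of j.  With 7 colours, and up to renaming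
-- colours, such a pair of sets is described by a few small numbers, and the degree bound 6 leaves
-- finitely many cases.  A finite table of colouring guarantees turns out to be closed under gluing
-- [i, w] to [w, j]; this is checked by computation, by searching for suitable renamings of the
-- colours of both parts.
module Submission where

open import Defs
open import Data.Bool using (Bool; true; false; T; _∧_; _∨_; not; if_then_else_)
open import Data.Bool.Properties using (T?; T-≡) renaming (_≟_ to _≟ᵇ_)
open import Data.Empty using (⊥; ⊥-elim)
open import Data.Fin using (Fin; zero; suc; toℕ; fromℕ<)
open import Data.Fin.Patterns using (0F; 1F)
open import Data.Fin.Permutation using (Permutation′; _⟨$⟩ʳ_; _⟨$⟩ˡ_; inverseˡ; inverseʳ)
open import Data.Fin.Properties using (_≟_; all?; any?; ∀-cons; toℕ<n; toℕ-injective; toℕ-fromℕ<)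
open import Data.Fin.Subset using (Subset; _∈_; _∉_)
open import Data.Fin.Subset.Properties using (_∈?_)
open import Data.List as List using (List; []; _∷_; [_]; _++_; length; concatMap; allFin; filterᵇ)
open import Data.List.Membership.Propositional using (find) renaming (_∈_ to _∈ˡ_)
open import Data.List.Membership.Propositional.Properties using (∈-∃++; ∈-++⁻; ∈-++⁺ˡ; ∈-++⁺ʳ; ∈-allFin; ∈-filter⁺; ∈-filter⁻)
open import Data.List.Properties using (length-++; length-map; length-tabulate)
open import Data.List.Relation.Binary.Subset.Propositional using (_⊆_)
open import Data.List.Relation.Unary.All as All using (All; []; _∷_)
open import Data.List.Relation.Unary.All.Properties using (++⁺)
open import Data.List.Relation.Unary.AllPairs as AllPairs using (AllPairs; []; _∷_)
import Data.List.Relation.Unary.AllPairs.Properties as AllPairs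
open import Data.List.Relation.Unary.Any as Any using (Any; here; there)
open import Data.List.Relation.Unary.Unique.Propositional using (Unique)
open import Data.List.Relation.Unary.Unique.Propositional.Properties using (allFin⁺; filter⁺)
open import Data.Nat using (ℕ; zero; suc; _+_; _∸_; _≤_; _<_; _≤ᵇ_; _<ᵇ_; z≤n; s≤s; s≤s⁻¹)
open import Data.Nat.Properties as ℕ using (≤-refl; ≤-reflexive; ≤-trans; <-trans; <-≤-trans; ≤-<-trans; <⇒≤; <⇒≢; <-irrefl; <-cmp; ≤∧≢⇒<; m≤n⇒m<n∨m≡n; n<1+n; m≤n⇒m≤1+n; <⇒≱; ≮⇒≥; ≰⇒>)
open import Data.Product using (∃; _×_; _,_; proj₁; proj₂; -,_)
open import Data.Sum using (_⊎_; inj₁; inj₂)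
open import Data.Unit using (tt)
open import Data.Vec using (Vec; []; _∷_; lookup; tabulate)
open import Function using (id; _∘_)
open import Function.Bundles using (Equivalence)
open import Relation.Binary.Definitions using (tri<; tri≈; tri>)
open import Relation.Binary.PropositionalEquality using (_≡_; _≢_; refl; trans; cong; cong₂; subst) renaming (sym to ≡-sym)
open import Relation.Nullary using (Dec; yes; no; ¬_; does; contradiction)
open import Relation.Nullary.Decidable using (_×-dec_; _→-dec_; ¬?; toWitness; dec-true; dec-false)

-- Palettes, states and kinds of intervals

Color : Set
Color = Fin 7

-- For an interval [i, j] whose ends are coloured 0F and 1F, left and right are the colours
-- permitted on the inner neighbours of i and of j respectively.
record Palettes : Set where
  constructor _&_
  field
    left right : Subset 7
open Palettes

-- tagˡ? says that the colour 1F of the right end is in the left palette, tagʳ? that 0F is in the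
-- right one; both are impossible when the ends are adjacent.  common is the size of the intersection.
record State : Set where
  constructor state
  field
    tagˡ? tagʳ? : Bool
    common      : ℕ
open State

pattern plain k = state false false k
pattern tagˡ  k = state true  false k
pattern tagʳ  k = state false true  k
pattern tagˡʳ k = state true  true  k

-- degˡ and degʳ count the inner neighbours of the two ends; every listed state can be coloured.
record Kind : Set where
  constructor kind
  field
    degˡ degʳ : ℕ
    states    : List State
open Kind

bit : Bool → ℕ
bit b = if b then 1 else 0

block : ℕ → ℕ → Vec Bool 5
block a b = tabulate λ t → (a ≤ᵇ toℕ t) ∧ (toℕ t <ᵇ b)

-- A normal form up to renaming colours: entry `t` of a `block` stands for colour `t + 2`. The right
-- block starts `common s` places before the left one ends, which fixes the overlap. A tag counts
-- towards the degree, so it leaves one colour fewer for the block.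
palettes : Kind → State → Palettes
palettes t s =
  (false ∷ tagˡ? s ∷ block 0 p) & (tagʳ? s ∷ false ∷ block a (a + q))
  where
  p = degˡ t ∸ bit (tagˡ? s)
  q = degʳ t ∸ bit (tagʳ? s)
  a = p ∸ common s

Plain : Palettes → Set
Plain S = 1F ∉ left S × 0F ∉ right S

-- Compatibility of two parts and the search for renamings

-- LeftOK and RightOK say how colours y of the two parts may be renamed to c when an interval with
-- palettes S is split at w into parts with palettes S₁ and S₂; b tells whether the left end is
-- adjacent to w, and w receives the image of 1F on the left and of 0F on the right.
LeftOK : Bool → Palettes → Palettes → Color → Color → Set
LeftOK b S S₁ y c =
  (y ≡ 0F → c ≡ 0F) ×
  (y ≡ 1F → c ∈ right S × (T b → c ∈ left S)) ×
  (y ∈ left S₁ → c ∈ left S) ×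
  (y ∈ right S₁ → c ≢ 1F)

leftOK? : ∀ b S S₁ y c → Dec (LeftOK b S S₁ y c)
leftOK? b S S₁ y c =
  ((y ≟ 0F) →-dec (c ≟ 0F)) ×-dec
  ((y ≟ 1F) →-dec ((c ∈? right S) ×-dec (T? b →-dec (c ∈? left S)))) ×-dec
  ((y ∈? left S₁) →-dec (c ∈? left S)) ×-dec
  ((y ∈? right S₁) →-dec ¬? (c ≟ 1F))

RightOK : Bool → Palettes → Palettes → Palettes → (Color → Color) → Color → Color → Set
RightOK b S S₁ S₂ σ y c =
  (y ≡ 0F → c ≡ σ 1F) ×
  (y ≡ 1F → c ≡ 1F) ×
  (y ∈ left S₂ → (T b → c ≢ 0F) × (∀ z → z ∈ right S₁ → σ z ≢ c)) ×
  (y ∈ right S₂ → c ∈ right S)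

rightOK? : ∀ b S S₁ S₂ σ y c → Dec (RightOK b S S₁ S₂ σ y c)
rightOK? b S S₁ S₂ σ y c =
  ((y ≟ 0F) →-dec (c ≟ σ 1F)) ×-dec
  ((y ≟ 1F) →-dec (c ≟ 1F)) ×-dec
  ((y ∈? left S₂) →-dec ((T? b →-dec ¬? (c ≟ 0F)) ×-dec
     all? (λ z → (z ∈? right S₁) →-dec ¬? (σ z ≟ c)))) ×-dec
  ((y ∈? right S₂) →-dec (c ∈? right S))

-- Stated for `Fin k` so that it can be built one colour at a time; `used` holds the values already
-- taken. At `k = 7` with nothing used, injectivity makes it a permutation of the colours.
record Renaming {k} (R : Fin k → Color → Set) (used : List Color) : Set where
  field
    rename : Fin k → Color
    ok     : ∀ y → R y (rename y)
    fresh  : ∀ y → All (rename y ≢_) used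
    inj    : ∀ y z → rename y ≡ rename z → y ≡ z
open Renaming

empty : ∀ {R used} → Renaming {0} R used
empty = record { rename = λ () ; ok = λ () ; fresh = λ () ; inj = λ () }

extend : ∀ {k R used} c → R 0F c → All (c ≢_) used →
         Renaming {k} (R ∘ suc) (c ∷ used) → Renaming R used
extend {R = R} {used} c Rc c∉ σ = record
  { rename = rename′
  ; ok     = ∀-cons Rc (ok σ)
  ; fresh  = ∀-cons c∉ (All.tail ∘ fresh σ)
  ; inj    = inj′
  }
  where
  rename′ : Fin _ → Color
  rename′ zero    = c
  rename′ (suc y) = rename σ y

  inj′ : ∀ y z → rename′ y ≡ rename′ z → y ≡ z
  inj′ zero    zero    _  = refl
  inj′ zero    (suc z) eq = contradiction (≡-sym eq) (All.head (fresh σ z))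
  inj′ (suc y) zero    eq = contradiction eq (All.head (fresh σ y))
  inj′ (suc y) (suc z) eq = cong suc (inj σ y z eq)

-- The arguments flagged as free come last and are unconstrained, so one completion is as good as any.
renamings : ∀ {k R} → (Fin k → Bool) → (∀ y c → Dec (R y c)) → ∀ used → List (Renaming {k} R used)
renamings {zero}      free R? used = empty ∷ []
renamings {suc k} {R} free R? used =
  (if free 0F then List.take 1 else id) (concatMap try (allFin 7))
  where
  try : Color → List (Renaming R used)
  try c with All.all? (λ d → ¬? (c ≟ d)) used ×-dec R? 0F c
  ... | yes (c∉ , Rc) = List.map (extend c Rc c∉) (renamings (free ∘ suc) (R? ∘ suc) (c ∷ used))
  ... | no  _         = []

-- In the normal form the right block starts no later than the left one ends, so the colours in
-- neither palette form a final segment. A bad flag could only lose renamings: each one found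
-- carries its own proofs.
free : Palettes → Color → Bool
free S 0F = false
free S 1F = false
free S y  = not (lookup (left S) y ∨ lookup (right S) y)

plain? : ∀ S → Dec (Plain S)
plain? S = ¬? (1F ∈? left S) ×-dec ¬? (0F ∈? right S)

record Split (b : Bool) (S S₁ S₂ : Palettes) : Set where
  constructor split
  field
    ρˡ : Renaming (LeftOK b S S₁) []
    ρʳ : Renaming (RightOK b S S₁ S₂ (rename ρˡ)) []

splits : ∀ b S S₁ S₂ → List (Split b S S₁ S₂)
splits b S S₁ S₂ = concatMap
  (λ σ → List.map (split σ) (renamings (free S₂) (rightOK? b S S₁ S₂ (rename σ)) []))
  (renamings (free S₁) (leftOK? b S S₁) [])

-- A part with adjacent ends promises colourings for plain palettes only. The ends of the right part
-- are adjacent, those of the left part exactly when `b` holds.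
Splits : Bool → Palettes → Palettes → Palettes → Set
Splits b S S₁ S₂ = (T b → Plain S₁) × Plain S₂ × T (not (List.null (splits b S S₁ S₂)))

splits? : ∀ b S S₁ S₂ → Dec (Splits b S S₁ S₂)
splits? b S S₁ S₂ = (T? b →-dec plain? S₁) ×-dec plain? S₂ ×-dec T? _

head-of : ∀ {A : Set} {xs : List A} → T (not (List.null xs)) → A
head-of {xs = x ∷ _} _ = x

-- No edge from `i` passes over `w` to an inner vertex, so `i` can gain only `w` as an inner
-- neighbour, while `j` always gains `w`. Every state promised by `t` must be backed by one state of
-- each part.
Composes : Bool → Kind → Kind → Kind → Set
Composes b l r t = degˡ t ≡ degˡ l + bit b × degʳ t ≡ suc (degʳ r) ×
  All (λ s → Any (λ s₁ → Any (λ s₂ →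
    Splits b (palettes t s) (palettes l s₁) (palettes r s₂)) (states r)) (states l)) (states t)

composes? : ∀ b l r t → Dec (Composes b l r t)
composes? b l r t = (degˡ t ℕ.≟ degˡ l + bit b) ×-dec (degʳ t ℕ.≟ suc (degʳ r)) ×-dec
  All.all? (λ s → Any.any? (λ s₁ → Any.any? (λ s₂ →
    splits? b (palettes t s) (palettes l s₁) (palettes r s₂)) (states r)) (states l)) (states t)

-- The table of kinds and its closure under gluing

-- Obtained as the least family closed under gluing, then thinned out while it stayed closed.
-- Two rows with equal degrees are alternatives: an interval satisfies at least one of them.
kinds : List Kind
kinds =
  kind 0 0 (plain 0 ∷ []) ∷
  kind 1 1 (plain 0 ∷ []) ∷
  kind 1 1 (plain 1 ∷ []) ∷
  kind 1 2 (plain 0 ∷ []) ∷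
  kind 1 2 (plain 1 ∷ []) ∷
  kind 1 3 (plain 1 ∷ []) ∷
  kind 1 4 (tagʳ 1 ∷ plain 1 ∷ []) ∷
  kind 1 5 (tagʳ 1 ∷ plain 1 ∷ []) ∷
  kind 1 6 (tagʳ 1 ∷ []) ∷
  kind 2 1 (plain 0 ∷ []) ∷
  kind 2 1 (plain 1 ∷ []) ∷
  kind 2 2 (plain 1 ∷ []) ∷
  kind 2 3 (plain 1 ∷ plain 2 ∷ []) ∷
  kind 2 4 (tagʳ 1 ∷ plain 2 ∷ plain 1 ∷ []) ∷
  kind 2 5 (tagʳ 2 ∷ plain 2 ∷ []) ∷
  kind 2 6 (tagʳ 2 ∷ []) ∷
  kind 3 1 (tagˡ 1 ∷ plain 1 ∷ []) ∷
  kind 3 2 (tagˡ 1 ∷ plain 1 ∷ plain 2 ∷ []) ∷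
  kind 3 3 (tagˡʳ 1 ∷ plain 2 ∷ plain 3 ∷ plain 1 ∷ []) ∷
  kind 3 4 (tagˡʳ 1 ∷ tagˡʳ 2 ∷ plain 2 ∷ plain 3 ∷ []) ∷
  kind 3 5 (tagˡʳ 2 ∷ tagˡʳ 1 ∷ plain 3 ∷ []) ∷
  kind 3 6 (tagʳ 3 ∷ []) ∷
  kind 4 1 (tagˡ 1 ∷ plain 1 ∷ []) ∷
  kind 4 2 (tagˡ 1 ∷ plain 2 ∷ plain 1 ∷ []) ∷
  kind 4 3 (tagˡʳ 1 ∷ plain 2 ∷ plain 3 ∷ []) ∷
  kind 4 4 (tagˡʳ 2 ∷ tagʳ 3 ∷ plain 3 ∷ plain 4 ∷ []) ∷
  kind 4 5 (tagˡʳ 3 ∷ tagˡʳ 2 ∷ plain 4 ∷ []) ∷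
  kind 4 6 (tagˡʳ 3 ∷ []) ∷
  kind 5 1 (tagˡ 1 ∷ plain 1 ∷ []) ∷
  kind 5 2 (tagˡ 2 ∷ plain 2 ∷ []) ∷
  kind 5 3 (tagˡʳ 2 ∷ plain 3 ∷ []) ∷
  kind 5 4 (tagˡʳ 3 ∷ tagˡʳ 2 ∷ plain 4 ∷ []) ∷
  kind 5 5 (tagˡʳ 4 ∷ tagˡʳ 3 ∷ plain 5 ∷ []) ∷
  kind 5 6 (tagˡʳ 4 ∷ []) ∷
  kind 6 1 (tagˡ 1 ∷ []) ∷
  kind 6 2 (tagˡ 2 ∷ []) ∷
  kind 6 3 (tagˡ 3 ∷ []) ∷
  kind 6 4 (tagˡʳ 3 ∷ []) ∷
  kind 6 5 (tagˡʳ 4 ∷ []) ∷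
  kind 6 6 (tagˡʳ 5 ∷ []) ∷
  []

-- The last bound is the degree of `w`: it sees `i` if `b` holds, the inner neighbours on both
-- sides, and `j`. The lower bound reflects that `i` is adjacent to its successor, which lies
-- strictly inside `[i, j]`.
Composable : Bool → Kind → Kind → Set
Composable b l r =
  1 ≤ degˡ l + bit b → degˡ l + bit b ≤ 6 → suc (degʳ r) ≤ 6 →
  bit b + (degʳ l + (degˡ r + 1)) ≤ 6 → Any (Composes b l r) kinds

composable? : ∀ b l r → Dec (Composable b l r)
composable? b l r =
  (1 ℕ.≤? (degˡ l + bit b)) →-dec ((degˡ l + bit b) ℕ.≤? 6) →-dec (suc (degʳ r) ℕ.≤? 6) →-dec
  ((bit b + (degʳ l + (degˡ r + 1))) ℕ.≤? 6) →-dec Any.any? (composes? b l r) kinds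

kinds-closed : All (λ l → All (λ r → Composable false l r × Composable true l r) kinds) kinds
kinds-closed = toWitness {a? = All.all? (λ l → All.all?
  (λ r → composable? false l r ×-dec composable? true l r) kinds) kinds} _

-- Picks the state for the whole order. If the two ends are adjacent, each has at most five inner
-- neighbours and a plain state is required; otherwise any state will do.
kinds-usable : All (λ t → Any (λ s → degˡ t ≤ 5 → degʳ t ≤ 5 → Plain (palettes t s)) (states t)) kinds
kinds-usable = toWitness {a? = All.all? (λ t → Any.any?
  (λ s → (degˡ t ℕ.≤? 5) →-dec (degʳ t ℕ.≤? 5) →-dec plain? (palettes t s)) (states t)) kinds} _

-- Extremal positions and increasing lists

least : ∀ {P : ℕ → Set} → (∀ x → Dec (P x)) → ∀ {a b} → a ≤ b → P b →
        ∃ λ w → a ≤ w × w ≤ b × P w × (∀ {x} → a ≤ x → x < w → ¬ P x)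
least {P} P? {a} {b} a≤b Pb = go (b ∸ a) a≤b (≤-reflexive (≡-sym (ℕ.m∸n+n≡m a≤b)))
  where
  go : ∀ d {a} → a ≤ b → b ≤ d + a →
       ∃ λ w → a ≤ w × w ≤ b × P w × (∀ {x} → a ≤ x → x < w → ¬ P x)
  go d {a} a≤b b≤d+a with P? a
  ... | yes Pa = a , ≤-refl , a≤b , Pa , λ a≤x x<a → contradiction a≤x (<⇒≱ x<a)
  ... | no ¬Pa with m≤n⇒m<n∨m≡n a≤b
  ...   | inj₂ refl = contradiction Pb ¬Pa
  go zero    a≤b b≤a | no _ | inj₁ a<b = contradiction b≤a (<⇒≱ a<b)
  go (suc d) {a} a≤b b≤1+d+a | no ¬Pa | inj₁ a<b =
    let w , a<w , w≤b , Pw , min = go d a<b (subst (b ≤_) (≡-sym (ℕ.+-suc d a)) b≤1+d+a)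
    in w , <⇒≤ a<w , w≤b , Pw , λ a≤x x<w → above a≤x (λ a<x → min a<x x<w)
    where
    above : ∀ {x} → a ≤ x → (a < x → ¬ P x) → ¬ P x
    above a≤x k with m≤n⇒m<n∨m≡n a≤x
    ... | inj₁ a<x  = k a<x
    ... | inj₂ refl = ¬Pa

greatest : ∀ {P : ℕ → Set} → (∀ x → Dec (P x)) → ∀ m →
           (∃ λ a → a ≤ m × P a × (∀ {x} → a < x → x ≤ m → ¬ P x)) ⊎ (∀ {x} → x ≤ m → ¬ P x)
greatest P? m with P? m
... | yes Pm = inj₁ (m , ≤-refl , Pm , λ m<x x≤m → contradiction x≤m (<⇒≱ m<x))
greatest P? zero | no ¬P0 = inj₂ λ { z≤n → ¬P0 }
greatest {P} P? (suc m) | no ¬Pm = extendRange (greatest P? m)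
  where
  below : ∀ {x} → x ≤ suc m → (x ≤ m → ¬ P x) → ¬ P x
  below x≤1+m k with m≤n⇒m<n∨m≡n x≤1+m
  ... | inj₁ x<1+m = k (s≤s⁻¹ x<1+m)
  ... | inj₂ refl  = ¬Pm

  extendRange : (∃ λ a → a ≤ m × P a × (∀ {x} → a < x → x ≤ m → ¬ P x)) ⊎ (∀ {x} → x ≤ m → ¬ P x) →
                (∃ λ a → a ≤ suc m × P a × (∀ {x} → a < x → x ≤ suc m → ¬ P x)) ⊎
                (∀ {x} → x ≤ suc m → ¬ P x)
  extendRange (inj₁ (a , a≤m , Pa , max)) =
    inj₁ (a , m≤n⇒m≤1+n a≤m , Pa , λ a<x x≤1+m → below x≤1+m (max a<x))
  extendRange (inj₂ none) = inj₂ λ x≤1+m → below x≤1+m none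

-- Increasing lists make distinctness of neighbours easy to keep when stretches of positions are
-- concatenated, so that their lengths can be compared with the degree.
Sorted : List ℕ → Set
Sorted = AllPairs _<_

sorted-++ : ∀ m {xs ys} → All (_< m) xs → All (m ≤_) ys → Sorted xs → Sorted ys → Sorted (xs ++ ys)
sorted-++ m xs<m m≤ys xs↗ ys↗ =
  AllPairs.++⁺ xs↗ ys↗ (All.map (λ x<m → All.map (<-≤-trans x<m) m≤ys) xs<m)

optional : Bool → ℕ → List ℕ
optional b x = if b then [ x ] else []

length-optional : ∀ b x → length (optional b x) ≡ bit b
length-optional true  x = refl
length-optional false x = refl

sorted-optional : ∀ b x → Sorted (optional b x)
sorted-optional true  x = [] ∷ []
sorted-optional false x = []

all-optional : ∀ {P : ℕ → Set} b x → (T b → P x) → All P (optional b x)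
all-optional true  x p = p tt ∷ []
all-optional false x p = []

-- Gluing the colourings of two intervals

-- edge and nbrs together say that c is proper on the square of the graph induced on [i, j].
record Fits (_~_ : ℕ → ℕ → Set) (c : ℕ → Color) (i j : ℕ) (S : Palettes) : Set where
  field
    start    : c i ≡ 0F
    end      : c j ≡ 1F
    startNbr : ∀ {x} → i < x → x < j → i ~ x → c x ∈ left S
    endNbr   : ∀ {x} → i < x → x < j → x ~ j → c x ∈ right S
    edge     : ∀ {x y} → i ≤ x → x < y → y ≤ j → x ~ y → c x ≢ c y
    nbrs     : ∀ {w x y} → i ≤ w → w ≤ j → i ≤ x → x < y → y ≤ j →
               w ~ x → w ~ y → c x ≢ c y

module Intervals
  (n : ℕ) (_~_ : ℕ → ℕ → Set) (_~?_ : ∀ x y → Dec (x ~ y))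
  (~-sym : ∀ {x y} → x ~ y → y ~ x) (~-irrefl : ∀ {x} → ¬ x ~ x)
  (noncrossing : ∀ {a b c d} → a ~ b → c ~ d → a < c → c < b → b < d → ⊥)
  (consecutive : ∀ {i} → suc i < n → i ~ suc i)
  (degree≤6 : ∀ {v xs} → Sorted xs → All (v ~_) xs → length xs ≤ 6)
  where

  module Glue
    {i w j b S S₁ S₂ c₁ c₂} (i<w : i < w) (w<j : w < j)
    (crossing : ∀ {x y} → i ≤ x → x < w → w < y → y ≤ j → x ~ y → x ≡ i × y ≡ j)
    (b-complete : i ~ w → T b) (S-plain : i ~ j → Plain S)
    (sp : Split b S S₁ S₂) (F₁ : Fits _~_ c₁ i w S₁) (F₂ : Fits _~_ c₂ w j S₂)
    where
    module F₁ = Fits F₁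
    module F₂ = Fits F₂

    open Split sp

    f g : Color → Color
    f = rename ρˡ
    g = rename ρʳ

    f0≡0 : f 0F ≡ 0F
    f0≡0 = let p , _ = ok ρˡ 0F in p refl

    f1∈right : f 1F ∈ right S
    f1∈right = let _ , p , _ = ok ρˡ 1F in proj₁ (p refl)

    f1∈left : T b → f 1F ∈ left S
    f1∈left = let _ , p , _ = ok ρˡ 1F in proj₂ (p refl)

    f-left : ∀ {y} → y ∈ left S₁ → f y ∈ left S
    f-left {y} = let _ , _ , p , _ = ok ρˡ y in p

    f≢1 : ∀ {y} → y ∈ right S₁ → f y ≢ 1F
    f≢1 {y} = let _ , _ , _ , p = ok ρˡ y in p

    f1≡g0 : f 1F ≡ g 0F
    f1≡g0 = let p , _ = ok ρʳ 0F in ≡-sym (p refl)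

    g1≡1 : g 1F ≡ 1F
    g1≡1 = let _ , p , _ = ok ρʳ 1F in p refl

    g≢0 : ∀ {y} → y ∈ left S₂ → T b → g y ≢ 0F
    g≢0 {y} y∈ = let _ , _ , p , _ = ok ρʳ y in proj₁ (p y∈)

    f≢g : ∀ {y z} → y ∈ left S₂ → z ∈ right S₁ → f z ≢ g y
    f≢g {y} y∈ = let _ , _ , p , _ = ok ρʳ y in proj₂ (p y∈) _

    g-right : ∀ {y} → y ∈ right S₂ → g y ∈ right S
    g-right {y} = let _ , _ , _ , p = ok ρʳ y in p

    c : ℕ → Color
    c x = if does (x ℕ.≤? w) then f (c₁ x) else g (c₂ x)

    c-left : ∀ {x} → x ≤ w → c x ≡ f (c₁ x)
    c-left {x} x≤w rewrite dec-true (x ℕ.≤? w) x≤w = refl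

    -- At `w` itself both descriptions apply; they agree because `g` sends `0F` to the image of `1F`
    -- under `f`.
    c-right : ∀ {x} → w ≤ x → c x ≡ g (c₂ x)
    c-right {x} w≤x with m≤n⇒m<n∨m≡n w≤x
    ... | inj₁ w<x  rewrite dec-false (x ℕ.≤? w) (<⇒≱ w<x) = refl
    ... | inj₂ refl = trans (c-left ≤-refl)
            (trans (cong f F₁.end) (trans f1≡g0 (cong g (≡-sym F₂.start))))

    c-left-≢ : ∀ {x y} → x ≤ w → y ≤ w → c₁ x ≢ c₁ y → c x ≢ c y
    c-left-≢ x≤w y≤w ne eq =
      ne (inj ρˡ _ _ (trans (≡-sym (c-left x≤w)) (trans eq (c-left y≤w))))

    c-right-≢ : ∀ {x y} → w ≤ x → w ≤ y → c₂ x ≢ c₂ y → c x ≢ c y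
    c-right-≢ w≤x w≤y ne eq =
      ne (inj ρʳ _ _ (trans (≡-sym (c-right w≤x)) (trans eq (c-right w≤y))))

    c-start : c i ≡ 0F
    c-start = trans (c-left (<⇒≤ i<w)) (trans (cong f F₁.start) f0≡0)

    c-end : c j ≡ 1F
    c-end = trans (c-right (<⇒≤ w<j)) (trans (cong g F₂.end) g1≡1)

    c-middle : c w ≡ f 1F
    c-middle = trans (c-left ≤-refl) (cong f F₁.end)

    c-startNbr : ∀ {x} → i < x → x < j → i ~ x → c x ∈ left S
    c-startNbr {x} i<x x<j i~x with <-cmp x w
    ... | tri< x<w _ _ = subst (_∈ left S) (≡-sym (c-left (<⇒≤ x<w)))
            (f-left (F₁.startNbr i<x x<w i~x))
    ... | tri≈ _ refl _ = subst (_∈ left S) (≡-sym c-middle) (f1∈left (b-complete i~x))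
    -- An edge from `i` over `w` ends at `j`, which is not an inner vertex.
    ... | tri> _ _ w<x = contradiction (proj₂ (crossing ≤-refl i<w w<x (<⇒≤ x<j) i~x)) (<⇒≢ x<j)

    c-endNbr : ∀ {x} → i < x → x < j → x ~ j → c x ∈ right S
    c-endNbr {x} i<x x<j x~j with <-cmp x w
    ... | tri> _ _ w<x = subst (_∈ right S) (≡-sym (c-right (<⇒≤ w<x)))
            (g-right (F₂.endNbr w<x x<j x~j))
    ... | tri≈ _ refl _ = subst (_∈ right S) (≡-sym c-middle) f1∈right
    ... | tri< x<w _ _ = contradiction (≡-sym (proj₁ (crossing (<⇒≤ i<x) x<w w<j ≤-refl x~j))) (<⇒≢ i<x)

    0≢1 : c i ≢ c j
    0≢1 eq with () ← trans (≡-sym c-start) (trans eq c-end)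

    c-edge : ∀ {x y} → i ≤ x → x < y → y ≤ j → x ~ y → c x ≢ c y
    c-edge {x} {y} i≤x x<y y≤j x~y with y ℕ.≤? w | w ℕ.≤? x
    ... | yes y≤w | _       = c-left-≢ (≤-trans (<⇒≤ x<y) y≤w) y≤w (F₁.edge i≤x x<y y≤w x~y)
    ... | no _    | yes w≤x = c-right-≢ w≤x (≤-trans w≤x (<⇒≤ x<y)) (F₂.edge w≤x x<y y≤j x~y)
    ... | no y≰w  | no w≰x with crossing i≤x (≰⇒> w≰x) (≰⇒> y≰w) y≤j x~y
    ...   | refl , refl = 0≢1

    -- Neighbours of `w` on opposite sides. The reason they differ depends on which of them are
    -- ends: the two end colours, `g≢0`, `f≢1`, or `f≢g` when both are inner.
    c-around : ∀ {x y} → i ≤ x → x < w → w < y → y ≤ j → w ~ x → w ~ y → c x ≢ c y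
    c-around {x} {y} i≤x x<w w<y y≤j w~x w~y eq
      with m≤n⇒m<n∨m≡n i≤x | m≤n⇒m<n∨m≡n y≤j
    ... | inj₂ refl | inj₂ refl = 0≢1 eq
    ... | inj₂ refl | inj₁ y<j  =
          g≢0 (F₂.startNbr w<y y<j w~y) (b-complete (~-sym w~x))
            (trans (≡-sym (c-right (<⇒≤ w<y))) (trans (≡-sym eq) c-start))
    ... | inj₁ i<x  | inj₂ refl =
          f≢1 (F₁.endNbr i<x x<w (~-sym w~x))
            (trans (≡-sym (c-left (<⇒≤ x<w))) (trans eq c-end))
    ... | inj₁ i<x  | inj₁ y<j  =
          f≢g (F₂.startNbr w<y y<j w~y) (F₁.endNbr i<x x<w (~-sym w~x))
            (trans (≡-sym (c-left (<⇒≤ x<w))) (trans eq (c-right (<⇒≤ w<y))))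

    -- If all three vertices lie in one part, that part decides; if `v` is `w`, `c-around` does.
    -- Otherwise an edge at `v` passes over `w`, so it joins `i` to `j`, and plainness of `S`
    -- separates the far end from the neighbours of `v`.
    c-nbrs : ∀ {v x y} → i ≤ v → v ≤ j → i ≤ x → x < y → y ≤ j → v ~ x → v ~ y → c x ≢ c y
    c-nbrs {v} {x} {y} i≤v v≤j i≤x x<y y≤j v~x v~y with <-cmp v w | y ℕ.≤? w | w ℕ.≤? x
    ... | tri< v<w _ _ | yes y≤w | _ =
          c-left-≢ (≤-trans (<⇒≤ x<y) y≤w) y≤w (F₁.nbrs i≤v (<⇒≤ v<w) i≤x x<y y≤w v~x v~y)
    ... | tri> _ _ w<v | _ | yes w≤x =
          c-right-≢ w≤x (≤-trans w≤x (<⇒≤ x<y)) (F₂.nbrs (<⇒≤ w<v) v≤j w≤x x<y y≤j v~x v~y)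
    ... | tri≈ _ refl _ | yes y≤w | _ =
          c-left-≢ (≤-trans (<⇒≤ x<y) y≤w) y≤w (F₁.nbrs i≤v ≤-refl i≤x x<y y≤w v~x v~y)
    ... | tri≈ _ refl _ | no _ | yes w≤x =
          c-right-≢ w≤x (≤-trans w≤x (<⇒≤ x<y)) (F₂.nbrs ≤-refl v≤j w≤x x<y y≤j v~x v~y)
    ... | tri≈ _ refl _ | no y≰w | no w≰x = c-around i≤x (≰⇒> w≰x) (≰⇒> y≰w) y≤j v~x v~y
    ... | tri< v<w _ _ | no y≰w | _ with crossing i≤v v<w (≰⇒> y≰w) y≤j v~y
    ...   | refl , refl = λ eq → proj₁ (S-plain v~y)
            (subst (_∈ left S) (trans eq c-end) (c-startNbr (≤∧≢⇒< i≤x λ { refl → ~-irrefl v~x }) x<y v~x))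
    c-nbrs {v} {x} {y} i≤v v≤j i≤x x<y y≤j v~x v~y
        | tri> _ _ w<v | _ | no w≰x with crossing i≤x (≰⇒> w≰x) w<v v≤j (~-sym v~x)
    ...   | refl , refl = λ eq → proj₂ (S-plain (~-sym v~x))
            (subst (_∈ right S) (trans (≡-sym eq) c-start) (c-endNbr x<y (≤∧≢⇒< y≤j λ { refl → ~-irrefl v~y }) (~-sym v~y)))

    glued : Fits _~_ c i j S
    glued = record
      { start = c-start ; end = c-end ; startNbr = c-startNbr ; endNbr = c-endNbr
      ; edge = c-edge ; nbrs = c-nbrs }

  -- Induction over intervals

  record Nbrs (v i j k : ℕ) : Set where
    field
      list   : List ℕ
      count  : length list ≡ k
      sorted : Sorted list
      inside : All (λ x → i < x × x < j × v ~ x) list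
  open Nbrs

  -- The induction hypothesis. `starts` and `ends` certify as many distinct inner neighbours as the
  -- kind claims, for use against the degree bound. Tagged states are promised only when the ends
  -- are not adjacent.
  record Piece (i j : ℕ) : Set where
    field
      type     : Kind
      listed   : type ∈ˡ kinds
      starts   : Nbrs i i j (degˡ type)
      ends     : Nbrs j i j (degʳ type)
      nonempty : ¬ i ~ j → 1 ≤ degˡ type
      colored  : ∀ {s} → s ∈ˡ states type → (i ~ j → Plain (palettes type s)) →
                 ∃ λ c → Fits _~_ c i j (palettes type s)
  open Piece

  edgePiece : ∀ i → i ~ suc i → Piece i (suc i)
  edgePiece i i~si = record
    { type     = kind 0 0 (plain 0 ∷ [])
    ; listed   = here refl
    ; starts   = none
    ; ends     = none
    ; nonempty = contradiction i~si
    ; colored  = λ { (here refl) _ → c , record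
        { start    = c-low ≤-refl
        ; end      = c-high
        ; startNbr = λ i<x x<si → contradiction (s≤s⁻¹ x<si) (<⇒≱ i<x)
        ; endNbr   = λ i<x x<si → contradiction (s≤s⁻¹ x<si) (<⇒≱ i<x)
        ; edge     = λ i≤x x<y y≤si _ → apart i≤x x<y y≤si
        ; nbrs     = λ _ _ i≤x x<y y≤si _ _ → apart i≤x x<y y≤si
        } }
    }
    where
    none : ∀ {v} → Nbrs v i (suc i) 0
    none = record { list = [] ; count = refl ; sorted = [] ; inside = [] }

    c : ℕ → Color
    c x = if does (x ℕ.≤? i) then 0F else 1F

    c-low : ∀ {x} → x ≤ i → c x ≡ 0F
    c-low {x} x≤i rewrite dec-true (x ℕ.≤? i) x≤i = refl

    c-high : c (suc i) ≡ 1F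
    c-high rewrite dec-false (suc i ℕ.≤? i) (<-irrefl refl) = refl

    apart : ∀ {x y} → i ≤ x → x < y → y ≤ suc i → c x ≢ c y
    apart i≤x x<y y≤si eq with ℕ.≤-antisym y≤si (≤-<-trans i≤x x<y)
    ... | refl with () ← trans (≡-sym (c-low (s≤s⁻¹ x<y))) (trans eq c-high)

  module Compose {i w j} (i<w : i < w) (w<j : w < j) (w~j : w ~ j)
    (crossing : ∀ {x y} → i ≤ x → x < w → w < y → y ≤ j → x ~ y → x ≡ i × y ≡ j)
    (L : Piece i w) (R : Piece w j)
    where

    b : Bool
    b = does (i ~? w)

    b-sound : T b → i ~ w
    b-sound h with i ~? w
    ... | yes i~w = i~w

    b-complete : i ~ w → T b
    b-complete i~w with i ~? w
    ... | yes _   = tt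
    ... | no  i≁w = i≁w i~w

    startNbrs : Nbrs i i j (degˡ (type L) + bit b)
    startNbrs = record
      { list   = list (starts L) ++ optional b w
      ; count  = trans (length-++ (list (starts L))) (cong₂ _+_ (count (starts L)) (length-optional b w))
      ; sorted = sorted-++ w (All.map (proj₁ ∘ proj₂) (inside (starts L)))
                   (all-optional b w λ _ → ≤-refl) (sorted (starts L)) (sorted-optional b w)
      ; inside = ++⁺ (All.map (λ (i<x , x<w , i~x) → i<x , <-trans x<w w<j , i~x) (inside (starts L)))
                   (all-optional b w λ h → i<w , w<j , b-sound h)
      }

    endNbrs : Nbrs j i j (suc (degʳ (type R)))
    endNbrs = record
      { list   = w ∷ list (ends R)
      ; count  = cong suc (count (ends R))
      ; sorted = All.map proj₁ (inside (ends R)) ∷ sorted (ends R)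
      ; inside = (i<w , w<j , ~-sym w~j) ∷
                 All.map (λ (w<x , x<j , j~x) → <-trans i<w w<x , x<j , j~x) (inside (ends R))
      }

    Nbrs≤6 : ∀ {v k} → Nbrs v i j k → k ≤ 6
    Nbrs≤6 N = subst (_≤ 6) (count N) (degree≤6 (sorted N) (All.map (proj₂ ∘ proj₂) (inside N)))

    -- Listed by position, the neighbours of `w` are `i` if adjacent, those inside the left part,
    -- those inside the right part, and `j`.
    middle≤6 : bit b + (degʳ (type L) + (degˡ (type R) + 1)) ≤ 6
    middle≤6 = subst (_≤ 6) size (degree≤6 ordered (++⁺ (all-optional b i (~-sym ∘ b-sound))
        (++⁺ (All.map (proj₂ ∘ proj₂) (inside (ends L)))
        (++⁺ (All.map (proj₂ ∘ proj₂) (inside (starts R))) (w~j ∷ [])))))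
      where
      size : length (optional b i ++ list (ends L) ++ list (starts R) ++ [ j ]) ≡
             bit b + (degʳ (type L) + (degˡ (type R) + 1))
      size = trans (length-++ (optional b i)) (cong₂ _+_ (length-optional b i)
        (trans (length-++ (list (ends L))) (cong₂ _+_ (count (ends L))
        (trans (length-++ (list (starts R))) (cong (_+ 1) (count (starts R)))))))

      ordered : Sorted (optional b i ++ list (ends L) ++ list (starts R) ++ [ j ])
      ordered =
        sorted-++ (suc i) (all-optional b i λ _ → ≤-refl)
          (++⁺ (All.map proj₁ (inside (ends L)))
          (++⁺ (All.map (λ (w<x , _) → <-trans i<w w<x) (inside (starts R))) (<-trans i<w w<j ∷ [])))
          (sorted-optional b i)
        (sorted-++ w (All.map (proj₁ ∘ proj₂) (inside (ends L)))
          (++⁺ (All.map (<⇒≤ ∘ proj₁) (inside (starts R))) (<⇒≤ w<j ∷ []))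
          (sorted (ends L))
        (sorted-++ j (All.map (proj₁ ∘ proj₂) (inside (starts R))) (≤-refl ∷ [])
          (sorted (starts R)) ([] ∷ [])))

    start≥1 : 1 ≤ degˡ (type L) + bit b
    start≥1 with i ~? w
    ... | yes _   = ℕ.m≤n+m 1 (degˡ (type L))
    ... | no  i≁w = ≤-trans (nonempty L i≁w) (ℕ.m≤m+n _ 0)

    composable : ∀ b → Composable b (type L) (type R)
    composable false = proj₁ (All.lookup (All.lookup kinds-closed (listed L)) (listed R))
    composable true  = proj₂ (All.lookup (All.lookup kinds-closed (listed L)) (listed R))

    fromKind : ∀ {t} → t ∈ˡ kinds → Composes b (type L) (type R) t → Piece i j
    fromKind {t} t∈ (refl , refl , splittable) = record
      { type     = t
      ; listed   = t∈
      ; starts   = startNbrs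
      ; ends     = endNbrs
      ; nonempty = λ _ → start≥1
      ; colored  = λ s∈ s-plain → color (All.lookup splittable s∈) s-plain
      }
      where
      color : ∀ {S} → Any (λ s₁ → Any (λ s₂ →
                Splits b S (palettes (type L) s₁) (palettes (type R) s₂)) (states (type R))) (states (type L)) →
              (i ~ j → Plain S) → ∃ λ c → Fits _~_ c i j S
      color found S-plain =
        let s₁ , s₁∈ , found′ = find found
            s₂ , s₂∈ , L-plain , R-plain , sp = find found′
            c₁ , F₁ = colored L s₁∈ (L-plain ∘ b-complete)
            c₂ , F₂ = colored R s₂∈ (λ _ → R-plain)
        in -, Glue.glued i<w w<j crossing b-complete S-plain (head-of sp) F₁ F₂

    piece : Piece i j
    piece = let t , t∈ , comp = find (composable b start≥1 (Nbrs≤6 startNbrs) (Nbrs≤6 endNbrs) middle≤6)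
            in fromKind t∈ comp

  -- Recursion on a bound `d` for the length; both parts are strictly shorter.
  piece : ∀ d {i j} → i < j → j < n → j ≤ d + i → Piece i j
  piece zero i<j _ j≤i = contradiction j≤i (<⇒≱ i<j)
  piece (suc d) {i} {suc j} i<sj sj<n sj≤ with m≤n⇒m<n∨m≡n (s≤s⁻¹ i<sj)
  ... | inj₂ refl = edgePiece i (consecutive sj<n)
  ... | inj₁ i<j  =
    -- The right end is adjacent to its predecessor, so it has a first neighbour after `i`.
    let w , i<w , w≤j , w~sj , min = least (_~? suc j) i<j (consecutive sj<n)
        w<sj = s≤s w≤j
        crossing : ∀ {x y} → i ≤ x → x < w → w < y → y ≤ suc j → x ~ y → x ≡ i × y ≡ suc j
        crossing i≤x x<w w<y y≤sj x~y = cross min w~sj i≤x x<w w<y y≤sj x~y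
    in Compose.piece i<w w<sj w~sj crossing
         (piece d i<w (<-trans w<sj sj<n) (≤-trans w≤j (s≤s⁻¹ sj≤)))
         (piece d w<sj sj<n (≤-trans (subst (suc j ≤_) (≡-sym (ℕ.+-suc d i)) sj≤) (ℕ.+-monoʳ-≤ d i<w)))
    where
    cross : ∀ {w x y} → (∀ {x} → i < x → x < w → ¬ x ~ suc j) → w ~ suc j →
            i ≤ x → x < w → w < y → y ≤ suc j → x ~ y → x ≡ i × y ≡ suc j
    cross min w~sj i≤x x<w w<y y≤sj x~y with m≤n⇒m<n∨m≡n y≤sj
    -- Such an edge would cross the one from `w` to the right end; one that reaches the right end
    -- must start at `i`, by minimality of `w`.
    ... | inj₁ y<sj = ⊥-elim (noncrossing x~y w~sj x<w w<y y<sj)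
    ... | inj₂ refl with m≤n⇒m<n∨m≡n i≤x
    ...   | inj₁ i<x  = contradiction x~y (min i<x x<w)
    ...   | inj₂ refl = refl , refl

  coloring : ∀ {m} → 0 < m → m < n → ∃ λ c → ∃ λ S → Fits _~_ c 0 m S
  coloring {m} 0<m m<n =
    let s , s∈ , usable = find (All.lookup kinds-usable (listed whole))
        c , F = colored whole s∈ (λ 0~m → usable (start≤5 0~m) (end≤5 0~m))
    in c , -, F
    where
    whole : Piece 0 m
    whole = piece m 0<m m<n (ℕ.m≤m+n m 0)

    -- The far end `m` is one more neighbour beside the inner ones.
    start≤5 : 0 ~ m → degˡ (type whole) ≤ 5
    start≤5 0~m = s≤s⁻¹ (subst (_≤ 6)
      (trans (length-++ (list N)) (trans (cong (_+ 1) (count N)) (ℕ.+-comm _ 1)))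
      (degree≤6 (sorted-++ m (All.map (proj₁ ∘ proj₂) (inside N)) (≤-refl ∷ []) (sorted N) ([] ∷ []))
        (++⁺ (All.map (proj₂ ∘ proj₂) (inside N)) (0~m ∷ []))))
      where N = starts whole

    end≤5 : 0 ~ m → degʳ (type whole) ≤ 5
    end≤5 0~m = s≤s⁻¹ (subst (_≤ 6) (cong suc (count N))
      (degree≤6 (All.map proj₁ (inside N) ∷ sorted N)
        (~-sym 0~m ∷ All.map (proj₂ ∘ proj₂) (inside N))))
      where N = ends whole

-- Counting, walks and the lower bound

unique⇒length≤ : ∀ {A : Set} {xs ys : List A} → Unique xs → xs ⊆ ys → length xs ≤ length ys
unique⇒length≤ {xs = []} _ _ = z≤n
unique⇒length≤ {xs = x ∷ xs} {ys} (x∉xs ∷ xs!) xs⊆ys with ∈-∃++ (xs⊆ys (here refl))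
... | as , bs , refl =
  subst (suc (length xs) ≤_) (≡-sym (trans (length-++ as) (trans (ℕ.+-suc _ _) (cong suc (≡-sym (length-++ as))))))
    (s≤s (unique⇒length≤ xs! λ z∈xs → drop z∈xs (∈-++⁻ as (xs⊆ys (there z∈xs)))))
  where
  drop : ∀ {z} → z ∈ˡ xs → z ∈ˡ as ⊎ z ∈ˡ (x ∷ bs) → z ∈ˡ (as ++ bs)
  drop _    (inj₁ z∈as)         = ∈-++⁺ˡ z∈as
  drop z∈xs (inj₂ (here refl))  = contradiction refl (All.lookup x∉xs z∈xs)
  drop _    (inj₂ (there z∈bs)) = ∈-++⁺ʳ as z∈bs

-- Turns connectivity into separation arguments: a vertex set closed under permitted steps traps
-- every walk that starts in it.
walk-preserves : ∀ {n} {G : Graph n} {Allowed : Fin n → Set} (S : Fin n → Set) →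
  (∀ {x y} → Edge G x y → Allowed y → S x → S y) →
  ∀ {x y} → Walk G Allowed x y → S x → S y
walk-preserves S closed here         Sx = Sx
walk-preserves S closed (step e a w) Sx = walk-preserves S closed w (closed e a Sx)

edge-sym : ∀ {n} (G : Graph n) {u v} → Edge G u v → Edge G v u
edge-sym G {u} {v} e = trans (Graph.sym G v u) e

edge-irrefl : ∀ {n} (G : Graph n) {v} → ¬ Edge G v v
edge-irrefl G {v} e with () ← trans (≡-sym (irrefl G v)) e

adj²-sym : ∀ {n} (G : Graph n) {u v} → Adj² G u v → Adj² G v u
adj²-sym G (u≢v , inj₁ e)            = u≢v ∘ ≡-sym , inj₁ (edge-sym G e)
adj²-sym G (u≢v , inj₂ (w , e , e′)) = u≢v ∘ ≡-sym , inj₂ (w , edge-sym G e′ , edge-sym G e)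

neighbours : ∀ {n} → Graph n → Fin n → List (Fin n)
neighbours {n} G v = filterᵇ (adj G v) (allFin n)

∈-neighbours⁺ : ∀ {n} (G : Graph n) {v u} → Edge G v u → u ∈ˡ neighbours G v
∈-neighbours⁺ G {v} {u} e =
  ∈-filter⁺ (T? ∘ adj G v) (∈-allFin u) (Equivalence.from T-≡ e)

∈-neighbours⁻ : ∀ {n} (G : Graph n) {v u} → u ∈ˡ neighbours G v → Edge G v u
∈-neighbours⁻ {n} G {v} u∈ =
  Equivalence.to T-≡ (proj₂ (∈-filter⁻ (T? ∘ adj G v) {xs = allFin n} u∈))

neighbours! : ∀ {n} (G : Graph n) v → Unique (neighbours G v)
neighbours! {n} G v = filter⁺ (T? ∘ adj G v) (allFin⁺ n)

AllPairs-∈ : ∀ {A : Set} {R S : A → A → Set} {xs} →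
  (∀ {x y} → x ∈ˡ xs → y ∈ˡ xs → R x y → S x y) → AllPairs R xs → AllPairs S xs
AllPairs-∈ f []          = []
AllPairs-∈ f (Rx ∷ Rxs) =
  All.tabulate (λ y∈ → f (here refl) (there y∈) (All.lookup Rx y∈)) ∷
  AllPairs-∈ (λ x∈ y∈ → f (there x∈) (there y∈)) Rxs

degree<colors : ∀ {n} (G : Graph n) v {k} → Colorable (Adj² G) k → suc (degree G v) ≤ k
degree<colors G v {k} (c , proper) =
  subst (_≤ k) (length-map c star)
    (subst (length (List.map c star) ≤_) (length-tabulate id)
      (unique⇒length≤ (AllPairs.map⁺ star-apart) (λ {x} _ → ∈-allFin x)))
  where
  star : List (Fin _)
  star = v ∷ neighbours G v

  star-apart : AllPairs (λ x y → c x ≢ c y) star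
  star-apart =
    All.tabulate (λ u∈ → let e = ∈-neighbours⁻ G u∈ in
      proper v _ ((λ { refl → edge-irrefl G e }) , inj₁ e)) ∷
    AllPairs-∈ (λ x∈ y∈ x≢y → proper _ _
      (x≢y , inj₂ (v , edge-sym G (∈-neighbours⁻ G x∈) , ∈-neighbours⁻ G y∈)))
      (neighbours! G v)

-- From the outerplanar order to intervals of positions

module Layout {n} (G : Graph n) (π : Permutation′ n)
  (planar : ∀ a b c d → Edge G a b → Edge G c d →
    ¬ (toℕ (π ⟨$⟩ʳ a) < toℕ (π ⟨$⟩ʳ c) × toℕ (π ⟨$⟩ʳ c) < toℕ (π ⟨$⟩ʳ b) × toℕ (π ⟨$⟩ʳ b) < toℕ (π ⟨$⟩ʳ d)))
  where

  pos : Fin n → ℕ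
  pos u = toℕ (π ⟨$⟩ʳ u)

  pos-injective : ∀ {u v} → pos u ≡ pos v → u ≡ v
  pos-injective eq = trans (≡-sym (inverseˡ π)) (trans (cong (π ⟨$⟩ˡ_) (toℕ-injective eq)) (inverseˡ π))

  vertex-at : ∀ {x} → x < n → ∃ λ u → pos u ≡ x
  vertex-at x<n = π ⟨$⟩ˡ fromℕ< x<n , trans (cong toℕ (inverseʳ π)) (toℕ-fromℕ< x<n)

  edge? : ∀ u v → Dec (Edge G u v)
  edge? u v = adj G u v ≟ᵇ true

  -- Vertices occur as witnesses so that adjacency makes sense for all naturals and fails outside
  -- the order.
  _~_ : ℕ → ℕ → Set
  x ~ y = ∃ λ u → ∃ λ v → pos u ≡ x × pos v ≡ y × Edge G u v

  _~?_ : ∀ x y → Dec (x ~ y)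
  x ~? y = any? λ u → any? λ v → (pos u ℕ.≟ x) ×-dec (pos v ℕ.≟ y) ×-dec edge? u v

  ~-edge : ∀ {u v} → Edge G u v → pos u ~ pos v
  ~-edge e = -, -, refl , refl , e

  ~-sym : ∀ {x y} → x ~ y → y ~ x
  ~-sym (u , v , p , q , e) = v , u , q , p , edge-sym G e

  ~-irrefl : ∀ {x} → ¬ x ~ x
  ~-irrefl (u , v , p , q , e) with pos-injective (trans p (≡-sym q))
  ... | refl = edge-irrefl G e

  noncrossing : ∀ {a b c d} → a ~ b → c ~ d → a < c → c < b → b < d → ⊥
  noncrossing (_ , _ , refl , refl , e) (_ , _ , refl , refl , e′) a<c c<b b<d =
    planar _ _ _ _ e e′ (a<c , c<b , b<d)

  module _ (connected : Connected G)
    (no-cut : ∀ v x y → x ≢ v → y ≢ v → Walk G (λ w → w ≢ v) x y)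
    where

    -- Otherwise the last a < i with a neighbour beyond i would separate (a, i] from i + 1.
    later-neighbour : ∀ {i} → suc i < n → ∃ λ b → i < b × i ~ b
    later-neighbour {i} si<n
      with vertex-at (<-trans (n<1+n i) si<n) | vertex-at si<n | greatest beyond? i
      where
      Beyond : ℕ → Set
      Beyond a = ∃ λ u → ∃ λ v → pos u ≡ a × i < pos v × Edge G u v

      beyond? : ∀ a → Dec (Beyond a)
      beyond? a = any? λ u → any? λ v → (pos u ℕ.≟ a) ×-dec (i ℕ.<? pos v) ×-dec edge? u v
    -- No edge at all leaves the positions up to `i`, against connectivity.
    ... | u , pu | u′ , pu′ | inj₂ none =
      contradiction (subst (_≤ i) pu′ (walk-preserves (λ x → pos x ≤ i)
        (λ e _ x≤i → ≮⇒≥ λ i<y → none x≤i (-, -, refl , i<y , e))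
        (connected u u′) (≤-reflexive pu))) (<⇒≱ (n<1+n i))
    ... | u , pu | u′ , pu′ | inj₁ (a , a≤i , (v , v′ , refl , i<v′ , e) , max)
        with m≤n⇒m<n∨m≡n a≤i
    ...   | inj₂ refl = pos v′ , i<v′ , ~-edge e
    ...   | inj₁ v<i  =
      contradiction (subst (_≤ i) pu′ (proj₂ (walk-preserves (λ x → pos v < pos x × pos x ≤ i)
        closed
        (no-cut v u u′ (λ { refl → <-irrefl pu v<i })
          (λ { refl → <-irrefl pu′ (<-trans v<i (n<1+n i)) }))
        (subst (pos v <_) (≡-sym pu) v<i , ≤-reflexive pu)))) (<⇒≱ (n<1+n i))
      where
      closed : ∀ {x y} → Edge G x y → y ≢ v → pos v < pos x × pos x ≤ i → pos v < pos y × pos y ≤ i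
      closed {x} {y} e′ y≢v (v<x , x≤i) with <-cmp (pos y) (pos v)
      -- A step to before `v` would cross the edge from `v` to `v′`; a step beyond `i` contradicts
      -- the choice of `v` as last.
      ... | tri< y<v _ _ = ⊥-elim (noncrossing (~-sym (~-edge e′)) (~-edge e) y<v v<x (≤-<-trans x≤i i<v′))
      ... | tri≈ _ y≡v _ = contradiction (pos-injective y≡v) y≢v
      ... | tri> _ _ v<y = v<y , ≮⇒≥ λ i<y → max v<x x≤i (-, -, refl , i<y , e′)

    -- Otherwise the first neighbour b > i + 1 of i would separate (i, b) from i.
    consecutive : ∀ {i} → suc i < n → i ~ suc i
    consecutive {i} si<n
      with b₀ , i<b₀ , i~b₀ ← later-neighbour si<n
      with b , i<b , _ , i~b , min ← least (i ~?_) i<b₀ i~b₀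
      with m≤n⇒m<n∨m≡n i<b
    ... | inj₂ refl = i~b
    ... | inj₁ si<b
      with u , w , refl , refl , e ← i~b
      with u′ , pu′ ← vertex-at si<n =
      contradiction (proj₁ (walk-preserves (λ x → pos u < pos x × pos x < pos w) closed
        (no-cut w u′ u (λ { refl → <-irrefl (≡-sym pu′) si<b }) (λ { refl → <-irrefl refl i<b }))
        (subst (pos u <_) (≡-sym pu′) (n<1+n _) , subst (_< pos w) (≡-sym pu′) si<b))) (<-irrefl refl)
      where
      closed : ∀ {x y} → Edge G x y → y ≢ w → pos u < pos x × pos x < pos w → pos u < pos y × pos y < pos w
      closed {x} {y} e′ y≢w (u<x , x<w) with <-cmp (pos y) (pos u) | <-cmp (pos y) (pos w)
      ... | tri< y<u _ _ | _ = ⊥-elim (noncrossing (~-sym (~-edge e′)) (~-edge e) y<u u<x x<w)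
      ... | tri≈ _ y≡u _ | _ = contradiction (subst (_~ pos x) y≡u (~-sym (~-edge e′))) (min u<x x<w)
      ... | tri> _ _ u<y | tri< y<w _ _ = u<y , y<w
      ... | tri> _ _ u<y | tri≈ _ y≡w _ = contradiction (pos-injective y≡w) y≢w
      ... | tri> _ _ u<y | tri> _ _ w<y = ⊥-elim (noncrossing (~-edge e) (~-edge e′) u<x x<w w<y)

  lift-neighbours : ∀ {v xs} → All (v ~_) xs →
    ∃ λ us → List.map pos us ≡ xs × All (λ u → ∃ λ v′ → pos v′ ≡ v × Edge G v′ u) us
  lift-neighbours [] = [] , refl , []
  lift-neighbours ((v′ , u , p , refl , e) ∷ v~xs) =
    let us , eq , es = lift-neighbours v~xs in u ∷ us , cong (pos u ∷_) eq , (v′ , p , e) ∷ es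

  sorted-neighbours≤ : ∀ {Δ} → (∀ v → degree G v ≤ Δ) →
    ∀ {v xs} → Sorted xs → All (v ~_) xs → length xs ≤ Δ
  sorted-neighbours≤ {Δ} bound xs↗ v~xs with lift-neighbours v~xs
  -- Without a listed neighbour there may be no vertex at position `v`, so no degree to compare
  -- with.
  ... | [] , refl , _ = z≤n
  ... | us@(_ ∷ _) , refl , es@((v , refl , _) ∷ _) =
    subst (_≤ Δ) (≡-sym (length-map pos us)) (≤-trans
      (unique⇒length≤ us! (λ u∈us → ∈-neighbours⁺ G (from-v (All.lookup es u∈us))))
      (bound v))
    where
    us! : Unique us
    us! = AllPairs.map (λ lt eq → <⇒≢ lt (cong pos eq)) (AllPairs.map⁻ xs↗)

    from-v : ∀ {u} → (∃ λ v′ → pos v′ ≡ pos v × Edge G v′ u) → Edge G v u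
    from-v (v′ , p , e) with refl ← pos-injective p = e

  adj²-apart : ∀ {m c S} → (∀ u → pos u ≤ m) → Fits _~_ c 0 m S →
    ∀ {u v} → pos u < pos v → Adj² G u v → c (pos u) ≢ c (pos v)
  adj²-apart ≤m F u<v (_ , inj₁ e) = Fits.edge F z≤n u<v (≤m _) (~-edge e)
  adj²-apart ≤m F u<v (_ , inj₂ (w , e , e′)) =
    Fits.nbrs F z≤n (≤m w) z≤n u<v (≤m _) (~-edge (edge-sym G e)) (~-edge e′)

  square-proper : ∀ {m c S} → (∀ u → pos u ≤ m) → Fits _~_ c 0 m S →
    ∀ u v → Adj² G u v → c (pos u) ≢ c (pos v)
  square-proper ≤m F u v uv with <-cmp (pos u) (pos v)
  ... | tri< u<v _ _ = adj²-apart ≤m F u<v uv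
  ... | tri≈ _ eq _  = contradiction (pos-injective eq) (proj₁ uv)
  ... | tri> _ _ v<u = adj²-apart ≤m F v<u (adj²-sym G uv) ∘ ≡-sym

square-7-colorable : ∀ {n} (G : Graph n) → Biconnected G → Outerplanar G →
  (∀ v → degree G v ≤ 6) → Colorable (Adj² G) 7
square-7-colorable {suc m} G (s≤s 2≤m , connected , no-cut) (π , planar) bound =
  let c , _ , F = coloring (≤-trans (s≤s z≤n) 2≤m) (n<1+n m)
  in c ∘ pos , square-proper (λ u → s≤s⁻¹ (toℕ<n (π ⟨$⟩ʳ u))) F
  where
  open Layout G π planar
  open Intervals (suc m) _~_ _~?_ ~-sym ~-irrefl noncrossing
    (consecutive connected no-cut) (sorted-neighbours≤ bound)

theorem6p8 : ∀ {n : ℕ} (G : Graph n) →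
    Biconnected G → Outerplanar G → MaxDegree G 6 →
    ChromaticNumber (Adj² G) 7
theorem6p8 G bi outer (bound , v , deg≡6) =
  square-7-colorable G bi outer bound ,
  λ j j<7 col → <⇒≱ j<7 (subst (λ d → suc d ≤ j) deg≡6 (degree<colors G v col))
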